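{- Let $b\ge1$ be an integer, and let $\Delta_{n,k}$ denote the number of vertices of the Horadam cube $\Pi^{1,b}_n$ with exactly $k$ neighbors. Then for all $n\ge3$ and all $k\ge 0$, $$\Delta_{n,k}=\Delta_{n-1,k-1}+\Delta_{n-2,k-1}+(b-1)\Delta_{n-2,k-2}+\Delta_{n-3,k-1}+(b-2)\Delta_{n-3,k-2}-(b-1)\Delta_{n-3,k-3},$$ with initial values $\Delta_{0,0}=1$, $\Delta_{1,0}=1$, $\Delta_{2,1}=2$ and $\Delta_{2,2}=b-1$ (all other $\Delta_{0,k}$, $\Delta_{1,k}$, $\Delta_{2,k}$ being $0$).
   Context: For an integer $b\ge1$ and $n\ge 0$, $\mathcal S^{1,b}_n$ is the set of all strings of length $n$ over the alphabet $\{0,1,\dots,b\}$ in which every letter from $\{1,\dots,b\}$ appears only immediately after a letter $0$; $\mathcal S^{1,b}_0$ contains only the empty string. The Horadam cube $\Pi^{1,b}_n$ is the simple graph with vertex set $\mathcal S^{1,b}_n$ in which $x_1\cdots x_n$ and $y_1\cdots y_n$ are adjacent if and only if $\sum_{i=1}^n|x_i-y_i|=1$. By convention $\Delta_{n,k}=0$ for $k<0$. -}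

module Defs where

open import Data.Fin.Base using (Fin; zero; toℕ)
open import Data.Fin.Properties using (all?; any?)
import Data.Fin.Properties as Fin
open import Data.Integer.Base using (ℤ; +_; -[1+_])
open import Data.List.Base
  using (List; [_]; length; filter; allFin; cartesianProductWith)
open import Data.List.Membership.Propositional using (_∈_)
open import Data.List.Membership.Propositional.Properties
  using (∈-allFin; ∈-cartesianProductWith⁺; ∈-filter⁺; ∈-filter⁻)
open import Data.List.Relation.Unary.All using ([])
open import Data.List.Relation.Unary.AllPairs using ([]; _∷_)
open import Data.List.Relation.Unary.Any using (here)
open import Data.List.Relation.Unary.Unique.Propositional using (Unique)
import Data.List.Relation.Unary.Unique.Propositional.Properties as Unique
open import Data.Nat.Base using (ℕ; zero; suc; ∣_-_∣)
import Data.Nat.Properties as ℕ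
open import Data.Product.Base using (_×_; _,_; ∃-syntax; proj₂)
open import Data.Vec.Base using (Vec; []; _∷_; lookup; sum; zipWith)
open import Data.Vec.Properties using (∷-injective)
open import Function.Bundles using (_⇔_; mk⇔)
open import Relation.Binary.Definitions using (Decidable)
open import Relation.Binary.PropositionalEquality using (_≡_; _≢_; refl)
open import Relation.Nullary.Decidable using (¬?; _×-dec_; _→-dec_)
import Relation.Unary as Unary

Str : ℕ → ℕ → Set
Str b n = Vec (Fin (suc b)) n

-- Every nonzero letter is immediately preceded by a letter 0; in particular
-- the first letter, having no predecessor, must be 0.
InS : ∀ {b n} → Str b n → Set
InS {n = n} x = ∀ (i : Fin n) → lookup x i ≢ zero →
  ∃[ j ] (toℕ i ≡ suc (toℕ j) × lookup x j ≡ zero)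

InS? : ∀ {b n} → Unary.Decidable (InS {b} {n})
InS? x = all? λ i → ¬? (lookup x i Fin.≟ zero) →-dec
  any? λ j → (toℕ i ℕ.≟ suc (toℕ j)) ×-dec (lookup x j Fin.≟ zero)

distance : ∀ {b n} → Str b n → Str b n → ℕ
distance x y = sum (zipWith (λ a c → ∣ toℕ a - toℕ c ∣) x y)

Adjacent : ∀ {b n} → Str b n → Str b n → Set
Adjacent x y = distance x y ≡ 1

Adjacent? : ∀ {b n} → Decidable (Adjacent {b} {n})
Adjacent? x y = distance x y ℕ.≟ 1

strings : ∀ b n → List (Str b n)
strings b zero    = [ [] ]
strings b (suc n) = cartesianProductWith _∷_ (allFin (suc b)) (strings b n)

vertices : ∀ b n → List (Str b n)
vertices b n = filter InS? (strings b n)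

degree : ∀ {b n} → Str b n → ℕ
degree {b} {n} x = length (filter (Adjacent? x) (vertices b n))

countDegree : ℕ → ℕ → ℕ → ℕ
countDegree b n k = length (filter (λ x → degree x ℕ.≟ k) (vertices b n))

Δ : ℕ → ℕ → ℤ → ℤ
Δ b n (+ k)    = + countDegree b n k
Δ b n -[1+ _ ] = + 0

-- The list of vertices contains every element of the vertex set exactly once,
-- so the lengths taken above are cardinalities.

∈-strings : ∀ {b n} (x : Str b n) → x ∈ strings b n
∈-strings []      = here refl
∈-strings (a ∷ x) = ∈-cartesianProductWith⁺ _∷_ (∈-allFin a) (∈-strings x)

strings-unique : ∀ b n → Unique (strings b n)
strings-unique b zero    = [] ∷ []
strings-unique b (suc n) = Unique.cartesianProductWith⁺ _∷_ ∷-injective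
  (Unique.allFin⁺ (suc b)) (strings-unique b n)

∈-vertices : ∀ {b n} (x : Str b n) → x ∈ vertices b n ⇔ InS x
∈-vertices {b} {n} x = mk⇔
  (λ x∈ → proj₂ (∈-filter⁻ InS? {xs = strings b n} x∈))
  (∈-filter⁺ InS? (∈-strings x))

vertices-unique : ∀ b n → Unique (vertices b n)
vertices-unique b n = Unique.filter⁺ InS? (strings-unique b n)

{-# OPTIONS --safe #-}

-- Read a vertex from left to right, remembering only whether the letter just
-- read is 0: this decides which letters may follow, and the degree is a sum of
-- local contributions.  Below a valid tail x, a leading nonzero letter a adds
-- to the degree of x the degree of a in the path 0, …, b, which is 1 for one of
-- the b letters and 2 for the b - 1 others.  A leading 0 that itself follows
-- a 0 adds 1 if x is empty or starts with 0, and nothing otherwise.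
-- With F n the degree generating polynomial of the cube and
-- w = t + (b - 1) t², this gives
--   F (n + 3) = t F (n + 2) + w F (n + 1) + (1 - t) w F n.
-- Polynomials are replaced by linear functionals: an arbitrary weight h on
-- degrees is summed over the vertices, and multiplication by t turns h into
-- h ∘ suc.
module Submission where

open import Data.Bool.Base using (Bool; true; false; T; _∧_; if_then_else_)
open import Data.Bool.Properties using (T?)
open import Data.Empty using (⊥-elim)
open import Data.Fin.Base using (Fin; zero; suc; toℕ)
open import Data.Integer.Base using (+_; _⊖_; _+_; _-_; _*_)
import Data.Integer.Properties as ℤ
open import Data.Integer.Tactic.RingSolver using (solve-∀)
open import Data.List.Base as List
  using (List; []; _∷_; map; tabulate; length; filter; cartesianProductWith)
open import Data.List.Properties using (map-++; map-cong; map-∘)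
open import Data.Nat.Base as ℕ
  using (ℕ; zero; suc; _∸_; ∣_-_∣; _≡ᵇ_; s≤s) renaming (_≤_ to _≤ℕ_)
import Data.Nat.ListAction as ListSum
open import Data.Nat.ListAction.Properties using (sum-++)
import Data.Nat.Properties as ℕ
import Data.Nat.Tactic.RingSolver as ℕSolver
open import Data.Product.Base using (_×_; _,_)
open import Data.Vec.Base using ([]; _∷_; lookup)
open import Defs
open import Function.Base using (_∘_)
open import Function.Bundles using (mk⇔)
open import Relation.Binary.PropositionalEquality
  using (_≡_; _≢_; refl; sym; trans; cong; cong₂; module ≡-Reasoning)
open import Relation.Nullary.Decidable using (does; does-⇔)
open import Relation.Unary using (Decidable)

open import Algebra.Properties.Semiring.Sum ℕ.+-*-semiring
  using (sum; sum-cong-≗; sum-replicate-zero)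

open ≡-Reasoning

-- Membership decided by a left-to-right scan.

𝟙 : Bool → ℕ
𝟙 p = if p then 1 else 0

-- The flag says whether the letter before the string is 0.
valid : ∀ {b n} → Bool → Str b n → Bool
valid p []          = true
valid p (zero ∷ x)  = valid true x
valid p (suc _ ∷ x) = p ∧ valid false x

valid-weaken : ∀ {b n} (x : Str b n) → T (valid false x) → T (valid true x)
valid-weaken []         _ = _
valid-weaken (zero ∷ x) v = v

-- Dropping a 0 that precedes another 0, or a leading pair of 0 and a nonzero letter, leaves the
-- value of `valid false` unchanged, so the induction stays at that flag.
valid⇒InS : ∀ {b n} (x : Str b n) → T (valid false x) → InS x
valid⇒InS (zero ∷ x) v zero x₀≢0 = ⊥-elim (x₀≢0 refl)
valid⇒InS (zero ∷ zero ∷ x) v (suc i) xᵢ≢0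
  with valid⇒InS (zero ∷ x) v i xᵢ≢0
... | j , i≡1+j , xⱼ≡0 = suc j , cong suc i≡1+j , xⱼ≡0
valid⇒InS (zero ∷ suc a ∷ x) v (suc zero) xᵢ≢0 = zero , refl , refl
valid⇒InS (zero ∷ suc a ∷ x) v (suc (suc i)) xᵢ≢0
  with valid⇒InS x v i xᵢ≢0
... | j , i≡1+j , xⱼ≡0 = suc (suc j) , cong (λ k → suc (suc k)) i≡1+j , xⱼ≡0

InS⇒valid : ∀ {b n} (x : Str b n) → InS x → T (valid false x)
InS⇒valid [] s = _
InS⇒valid (suc a ∷ x) s with () ← s zero (λ ())
InS⇒valid (zero ∷ []) s = _
InS⇒valid (zero ∷ zero ∷ x) s = InS⇒valid (zero ∷ x) s′
  where
  s′ : InS (zero ∷ x)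
  s′ i xᵢ≢0 with s (suc i) xᵢ≢0
  ... | zero  , 1+i≡1 , _    = ⊥-elim (xᵢ≢0 (lookup-first i (ℕ.suc-injective 1+i≡1)))
    where
    lookup-first : ∀ i → toℕ i ≡ 0 → lookup (zero ∷ x) i ≡ zero
    lookup-first zero _ = refl
  ... | suc j , 1+i≡2+j , xⱼ≡0 = j , ℕ.suc-injective 1+i≡2+j , xⱼ≡0
InS⇒valid (zero ∷ suc a ∷ x) s = InS⇒valid x s′
  where
  s′ : InS x
  s′ i xᵢ≢0 with s (suc (suc i)) xᵢ≢0
  -- The preceding 0 cannot be the dropped letter `suc a`, so it lies in `x`.
  ... | suc (suc j) , 2+i≡3+j , xⱼ≡0 =
    j , ℕ.suc-injective (ℕ.suc-injective 2+i≡3+j) , xⱼ≡0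

does-InS? : ∀ {b n} (x : Str b n) → does (InS? x) ≡ valid false x
does-InS? x = does-⇔ (mk⇔ (InS⇒valid x) (valid⇒InS x)) (InS? x) (T? (valid false x))

-- Cardinalities as recursive sums.

-- Branching on the flag as `valid` does makes splitting off a letter definitional.
∑ᵥ : ∀ {b} → Bool → ∀ n → (Str b n → ℕ) → ℕ
∑ᵥ p     zero    f = f []
∑ᵥ true  (suc n) f =
  ∑ᵥ true n (f ∘ (zero ∷_)) ℕ.+ sum (λ a → ∑ᵥ false n (f ∘ (suc a ∷_)))
∑ᵥ false (suc n) f = ∑ᵥ true n (f ∘ (zero ∷_))

∑ᵥ-cong : ∀ {b} p n {f g : Str b n → ℕ} →
  (∀ x → T (valid p x) → f x ≡ g x) → ∑ᵥ p n f ≡ ∑ᵥ p n g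
∑ᵥ-cong p     zero    eq = eq [] _
∑ᵥ-cong true  (suc n) eq = cong₂ ℕ._+_
  (∑ᵥ-cong true n (eq ∘ (zero ∷_)))
  (sum-cong-≗ λ a → ∑ᵥ-cong false n (eq ∘ (suc a ∷_)))
∑ᵥ-cong false (suc n) eq = ∑ᵥ-cong true n (eq ∘ (zero ∷_))

∑ᵥ-zero : ∀ {b} p n → ∑ᵥ {b} p n (λ _ → 0) ≡ 0
∑ᵥ-zero         p     zero    = refl
∑ᵥ-zero {b} true  (suc n) = cong₂ ℕ._+_ (∑ᵥ-zero {b} true n)
  (trans (sum-cong-≗ {b} λ _ → ∑ᵥ-zero {b} false n) (sum-replicate-zero b))
∑ᵥ-zero {b} false (suc n) = ∑ᵥ-zero {b} true n

listSum : ∀ {A : Set} → (A → ℕ) → List A → ℕ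
listSum f xs = ListSum.sum (map f xs)

listSum-zero : ∀ {A : Set} (xs : List A) → listSum (λ _ → 0) xs ≡ 0
listSum-zero []       = refl
listSum-zero (_ ∷ xs) = listSum-zero xs

length-filter-filter : ∀ {A : Set} {P Q : A → Set}
  (P? : Decidable P) (Q? : Decidable Q) (xs : List A) →
  length (filter Q? (filter P? xs))
    ≡ listSum (λ x → if does (P? x) then 𝟙 (does (Q? x)) else 0) xs
length-filter-filter P? Q? [] = refl
length-filter-filter P? Q? (x ∷ xs) with does (P? x)
... | false = length-filter-filter P? Q? xs
... | true with does (Q? x)
...   | false = length-filter-filter P? Q? xs
...   | true  = cong suc (length-filter-filter P? Q? xs)

listSum-cartesianProductWith : ∀ {A B : Set} {m} (f : B → ℕ) (_⊕_ : Fin m → A → B)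
  {k} (g : Fin k → Fin m) (xs : List A) →
  listSum f (cartesianProductWith _⊕_ (tabulate g) xs)
    ≡ sum (λ i → listSum (f ∘ (g i ⊕_)) xs)
listSum-cartesianProductWith f _⊕_ {zero}  g xs = refl
listSum-cartesianProductWith f _⊕_ {suc k} g xs = begin
  listSum f (map (g zero ⊕_) xs List.++ rest)
    ≡⟨ cong ListSum.sum (map-++ f (map (g zero ⊕_) xs) rest) ⟩
  ListSum.sum (map f (map (g zero ⊕_) xs) List.++ map f rest)
    ≡⟨ sum-++ (map f (map (g zero ⊕_) xs)) (map f rest) ⟩
  listSum f (map (g zero ⊕_) xs) ℕ.+ listSum f rest
    ≡⟨ cong₂ ℕ._+_ (cong ListSum.sum (sym (map-∘ xs)))
         (listSum-cartesianProductWith f _⊕_ (g ∘ suc) xs) ⟩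
  listSum (f ∘ (g zero ⊕_)) xs ℕ.+ sum (λ i → listSum (f ∘ (g (suc i) ⊕_)) xs) ∎
  where rest = cartesianProductWith _⊕_ (tabulate (g ∘ suc)) xs

listSum-valid : ∀ {b} p n (f : Str b n → ℕ) →
  listSum (λ x → if valid p x then f x else 0) (strings b n) ≡ ∑ᵥ p n f
listSum-valid p zero f = ℕ.+-identityʳ (f [])
listSum-valid {b} true (suc n) f = trans
  (listSum-cartesianProductWith _ _∷_ (λ i → i) (strings b n))
  (cong₂ ℕ._+_ (listSum-valid true n _)
    (sum-cong-≗ {b} λ a → listSum-valid false n (f ∘ (suc a ∷_))))
listSum-valid {b} false (suc n) f = begin
  _ ≡⟨ listSum-cartesianProductWith _ _∷_ (λ i → i) (strings b n) ⟩
  _ ≡⟨ cong₂ ℕ._+_ (listSum-valid true n _)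
         (sum-cong-≗ {b} λ _ → listSum-zero (strings b n)) ⟩
  ∑ᵥ true n (f ∘ (zero ∷_)) ℕ.+ sum {b} (λ _ → 0)
    ≡⟨ cong (∑ᵥ true n (f ∘ (zero ∷_)) ℕ.+_) (sum-replicate-zero b) ⟩
  ∑ᵥ true n (f ∘ (zero ∷_)) ℕ.+ 0
    ≡⟨ ℕ.+-identityʳ _ ⟩
  ∑ᵥ true n (f ∘ (zero ∷_)) ∎

-- Serves both for the neighbors of a vertex and for the vertices of a given degree.
length-filter-vertices : ∀ {b n} {Q : Str b n → Set} (Q? : Decidable Q) →
  length (filter Q? (vertices b n)) ≡ ∑ᵥ false n (𝟙 ∘ does ∘ Q?)
length-filter-vertices {b} {n} Q? = begin
  length (filter Q? (vertices b n))
    ≡⟨ length-filter-filter InS? Q? (strings b n) ⟩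
  listSum (λ x → if does (InS? x) then 𝟙 (does (Q? x)) else 0) (strings b n)
    ≡⟨ cong ListSum.sum (map-cong
         (λ x → cong (λ v → if v then 𝟙 (does (Q? x)) else 0) (does-InS? x))
         (strings b n)) ⟩
  listSum (λ x → if valid false x then 𝟙 (does (Q? x)) else 0) (strings b n)
    ≡⟨ listSum-valid false n (𝟙 ∘ does ∘ Q?) ⟩
  ∑ᵥ false n (𝟙 ∘ does ∘ Q?) ∎

-- Degrees as sums of local contributions.

below above : ∀ {m} → Fin m → ℕ
below zero    = 0
below (suc _) = 1
above {suc zero}    zero    = 0
above {suc (suc _)} zero    = 1
above               (suc a) = above a

-- Only distances 0 and 1 survive `far`: the letter itself and its neighbors in the path.
sum-near : ∀ {m} (φ : ℕ → ℕ) → (∀ d → φ (2 ℕ.+ d) ≡ 0) → (a : Fin m) →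
  sum {m} (λ c → φ ∣ toℕ a - toℕ c ∣) ≡ φ 0 ℕ.+ (below a ℕ.+ above a) ℕ.* φ 1
sum-near {suc zero}    φ far zero = refl
sum-near {suc (suc m)} φ far zero = cong (φ 0 ℕ.+_) (cong (φ 1 ℕ.+_)
  (trans (sum-cong-≗ {m} λ c → far (toℕ c)) (sum-replicate-zero m)))
sum-near {suc (suc m)} φ far (suc zero) = trans
  (cong (φ 1 ℕ.+_) (sum-near {suc m} φ far zero))
  (swap (φ 0) (φ 1) (above {suc m} zero))
  where
  swap : ∀ x y z → y ℕ.+ (x ℕ.+ z ℕ.* y) ≡ x ℕ.+ (y ℕ.+ z ℕ.* y)
  swap = ℕSolver.solve-∀
sum-near φ far (suc (suc a)) =
  cong₂ ℕ._+_ (far (toℕ a)) (sum-near φ far (suc a))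

-- Only the last letter has none above it. This is the source of the two terms of `w`.
sum-above : ∀ m (h : ℕ → ℕ) → sum {suc m} (h ∘ above) ≡ h 0 ℕ.+ m ℕ.* h 1
sum-above zero    h = refl
sum-above (suc m) h =
  trans (cong (h 1 ℕ.+_) (sum-above m h)) (swap (h 0) (h 1) (m ℕ.* h 1))
  where
  swap : ∀ x y z → y ℕ.+ (x ℕ.+ z) ≡ x ℕ.+ (y ℕ.+ z)
  swap = ℕSolver.solve-∀

-- The number of continuations of a string that differ from a given one by
-- one in total, when the strings before them already differ by e.
near : ∀ {b n} → ℕ → Bool → Str b n → ℕ
near {n = n} e p x = ∑ᵥ p n (λ y → 𝟙 (e ℕ.+ distance x y ≡ᵇ 1))

deg : ∀ {b n} → Bool → Str b n → ℕ
deg = near 0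

near-2+ : ∀ {b n} e p (x : Str b n) → near (2 ℕ.+ e) p x ≡ 0
near-2+ {b} {n} e p x = ∑ᵥ-zero {b} p n

-- The one unit of distance is already spent, so only `x` itself can be counted, and it is a summand
-- exactly when it is valid.
near-1 : ∀ {b n} p (x : Str b n) → near 1 p x ≡ 𝟙 (valid p x)
near-1 p [] = refl
near-1 {b} {suc n} true (zero ∷ x) = begin
  near 1 true x ℕ.+ sum {b} (λ c → near (2 ℕ.+ toℕ c) false x)
    ≡⟨ cong (near 1 true x ℕ.+_) (trans
         (sum-cong-≗ {b} λ c → near-2+ (toℕ c) false x) (sum-replicate-zero b)) ⟩
  near 1 true x ℕ.+ 0
    ≡⟨ ℕ.+-identityʳ _ ⟩
  near 1 true x
    ≡⟨ near-1 true x ⟩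
  𝟙 (valid true x) ∎
near-1 false (zero ∷ x) = near-1 true x
near-1 {b} {suc n} true (suc a ∷ x) = begin
  near (2 ℕ.+ toℕ a) true x ℕ.+ sum {b} (λ c → near (1 ℕ.+ ∣ toℕ a - toℕ c ∣) false x)
    ≡⟨ cong₂ ℕ._+_ (near-2+ (toℕ a) true x)
         (sum-near (λ d → near (1 ℕ.+ d) false x) (λ d → near-2+ (suc d) false x) a) ⟩
  near 1 false x ℕ.+ (below a ℕ.+ above a) ℕ.* near 2 false x
    ≡⟨ cong₂ (λ u v → u ℕ.+ (below a ℕ.+ above a) ℕ.* v)
         (near-1 false x) (near-2+ 0 false x) ⟩
  𝟙 (valid false x) ℕ.+ (below a ℕ.+ above a) ℕ.* 0
    ≡⟨ cong (𝟙 (valid false x) ℕ.+_) (ℕ.*-zeroʳ (below a ℕ.+ above a)) ⟩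
  𝟙 (valid false x) ℕ.+ 0
    ≡⟨ ℕ.+-identityʳ _ ⟩
  𝟙 (valid false x) ∎
near-1 {b} {suc n} false (suc a ∷ x) = near-2+ (toℕ a) true x

𝟙-T : ∀ {p} → T p → 𝟙 p ≡ 1
𝟙-T {true} _ = refl

-- The leading 0 can only be raised to 1 with the tail kept, which needs a tail valid after a
-- nonzero letter; larger letters are too far away.
deg-zero : ∀ {c n} (x : Str (suc c) n) →
  deg true (zero ∷ x) ≡ 𝟙 (valid false x) ℕ.+ deg true x
deg-zero {c} x = begin
  deg true x ℕ.+ (near 1 false x ℕ.+ sum {c} (λ i → near (2 ℕ.+ toℕ i) false x))
    ≡⟨ cong (deg true x ℕ.+_) (cong₂ ℕ._+_ (near-1 false x) (trans
         (sum-cong-≗ {c} λ i → near-2+ (toℕ i) false x) (sum-replicate-zero c))) ⟩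
  deg true x ℕ.+ (𝟙 (valid false x) ℕ.+ 0)
    ≡⟨ swap (deg true x) (𝟙 (valid false x)) ⟩
  𝟙 (valid false x) ℕ.+ deg true x ∎
  where
  swap : ∀ u v → u ℕ.+ (v ℕ.+ 0) ≡ v ℕ.+ u
  swap = ℕSolver.solve-∀

-- Each nonzero letter has one neighbor below: for the letter 1 it is 0, counted by `near`;
-- otherwise it is nonzero, counted by `below`.
near-suc : ∀ {b n m} (a : Fin m) (x : Str b n) → T (valid false x) →
  near (suc (toℕ a)) true x ℕ.+ below a ≡ 1
near-suc zero    x v = trans (ℕ.+-identityʳ _)
  (trans (near-1 true x) (𝟙-T (valid-weaken x v)))
near-suc (suc a) x v = cong (ℕ._+ 1) (near-2+ (toℕ a) true x)

deg-suc : ∀ {b n} (a : Fin b) (x : Str b n) → T (valid false x) →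
  deg true (suc a ∷ x) ≡ suc (above a ℕ.+ deg false x)
deg-suc {b} a x v = begin
  near (suc (toℕ a)) true x ℕ.+ sum {b} (λ c → near ∣ toℕ a - toℕ c ∣ false x)
    ≡⟨ cong (near (suc (toℕ a)) true x ℕ.+_)
         (sum-near (λ d → near d false x) (λ d → near-2+ d false x) a) ⟩
  near (suc (toℕ a)) true x ℕ.+
    (deg false x ℕ.+ (below a ℕ.+ above a) ℕ.* near 1 false x)
    ≡⟨ cong (λ u → near (suc (toℕ a)) true x ℕ.+
                     (deg false x ℕ.+ (below a ℕ.+ above a) ℕ.* u))
         (trans (near-1 false x) (𝟙-T v)) ⟩
  near (suc (toℕ a)) true x ℕ.+ (deg false x ℕ.+ (below a ℕ.+ above a) ℕ.* 1)
    ≡⟨ regroup (near (suc (toℕ a)) true x) (deg false x) (below a) (above a) ⟩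
  (near (suc (toℕ a)) true x ℕ.+ below a) ℕ.+ (above a ℕ.+ deg false x)
    ≡⟨ cong (ℕ._+ (above a ℕ.+ deg false x)) (near-suc a x v) ⟩
  suc (above a ℕ.+ deg false x) ∎
  where
  regroup : ∀ r d l u → r ℕ.+ (d ℕ.+ (l ℕ.+ u) ℕ.* 1) ≡ (r ℕ.+ l) ℕ.+ (u ℕ.+ d)
  regroup = ℕSolver.solve-∀

-- Recurrence for weighted sums over degrees.

module _ (c : ℕ) where

  private b = suc c

  F : ℕ → (ℕ → ℕ) → ℕ
  F n h = ∑ᵥ {b} false n (h ∘ deg false)

  -- The part of F (n + 2) from the vertices that begin with 00.
  Z : ℕ → (ℕ → ℕ) → ℕ
  Z n h = ∑ᵥ {b} true n (λ x → h (deg true (zero ∷ x)))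

  -- The functional of the product `w F n`, with `c` in the role of b - 1.
  W : ℕ → (ℕ → ℕ) → ℕ
  W n h = F n (h ∘ suc) ℕ.+ c ℕ.* F n (λ d → h (suc (suc d)))

  sum-nonzero : ∀ n h →
    sum (λ a → ∑ᵥ {b} false n (λ x → h (deg true (suc a ∷ x)))) ≡ W n h
  sum-nonzero n h = trans
    (sum-cong-≗ {b} λ a → ∑ᵥ-cong false n λ x v → cong h (deg-suc a x v))
    (sum-above c λ u → F n λ d → h (suc (u ℕ.+ d)))

  F-2+ : ∀ n h → F (2 ℕ.+ n) h ≡ Z n h ℕ.+ W n h
  -- The forced first 0 contributes nothing: `deg false (zero ∷ y)` reduces to `deg true y`. The sum
  -- then splits by the second letter.
  F-2+ n h = cong (Z n h ℕ.+_) (sum-nonzero n h)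

  -- Split by the third letter: after 000 the second 0 can be raised and adds 1; before a nonzero
  -- letter it cannot, and adds 0.
  Z-suc : ∀ n h → Z (suc n) h ≡ Z n (h ∘ suc) ℕ.+ W n h
  Z-suc n h = cong₂ ℕ._+_
    (∑ᵥ-cong true n λ x v → cong h
      (trans (deg-zero (zero ∷ x)) (cong (ℕ._+ deg true (zero ∷ x)) (𝟙-T v))))
    (trans (sum-cong-≗ {b} λ a → ∑ᵥ-cong false n λ x v → cong h (deg-zero (suc a ∷ x)))
      (sum-nonzero n h))

  -- The term -t w F n is moved to the left, so that everything stays in ℕ.
  F-recurrence : ∀ n h →
    F (3 ℕ.+ n) h ℕ.+ W n (h ∘ suc) ≡ F (2 ℕ.+ n) (h ∘ suc) ℕ.+ W n h ℕ.+ W (suc n) h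
  F-recurrence n h = begin
    F (3 ℕ.+ n) h ℕ.+ W n (h ∘ suc)
      ≡⟨ cong (ℕ._+ W n (h ∘ suc)) (trans (F-2+ (suc n) h)
           (cong (ℕ._+ W (suc n) h) (Z-suc n h))) ⟩
    Z n (h ∘ suc) ℕ.+ W n h ℕ.+ W (suc n) h ℕ.+ W n (h ∘ suc)
      -- Bringing the two sums weighted by `h ∘ suc` together lets `F-2+`, read backwards, eliminate
      -- `Z`.
      ≡⟨ regroup (Z n (h ∘ suc)) (W n h) (W (suc n) h) (W n (h ∘ suc)) ⟩
    Z n (h ∘ suc) ℕ.+ W n (h ∘ suc) ℕ.+ W n h ℕ.+ W (suc n) h
      ≡⟨ cong (λ u → u ℕ.+ W n h ℕ.+ W (suc n) h) (F-2+ n (h ∘ suc)) ⟨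
    F (2 ℕ.+ n) (h ∘ suc) ℕ.+ W n h ℕ.+ W (suc n) h ∎
    where
    regroup : ∀ x y z w → x ℕ.+ y ℕ.+ z ℕ.+ w ≡ x ℕ.+ w ℕ.+ y ℕ.+ z
    regroup = ℕSolver.solve-∀

  countDegree≡F : ∀ n k → countDegree b n k ≡ F n (λ d → 𝟙 (d ≡ᵇ k))
  countDegree≡F n k = trans (length-filter-vertices {b} {n} (λ x → degree x ℕ.≟ k))
    (∑ᵥ-cong false n λ x _ →
      cong (λ d → 𝟙 (d ≡ᵇ k)) (length-filter-vertices (Adjacent? x)))

  Δ-⊖ : ∀ n k e → Δ b n (k ⊖ e) ≡ + F n (λ d → 𝟙 (e ℕ.+ d ≡ᵇ k))
  Δ-⊖ n k       zero    = cong (+_) (countDegree≡F n k)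
  -- The index is negative, where `Δ` is 0 by convention; on the right `suc e + d ≡ᵇ 0` is `false`
  -- for every `d`.
  Δ-⊖ n zero    (suc e) = cong (+_) (sym (∑ᵥ-zero {b} false n))
  Δ-⊖ n (suc k) (suc e) =
    trans (cong (Δ b n) (ℤ.[1+m]⊖[1+n]≡m⊖n k e)) (Δ-⊖ n k e)

  Δ-shift : ∀ n k e → Δ b n (+ k - + e) ≡ + F n (λ d → 𝟙 (e ℕ.+ d ≡ᵇ k))
  Δ-shift n k e = trans (cong (Δ b n) (ℤ.m-n≡m⊖n k e)) (Δ-⊖ n k e)

  Δ≡F : ∀ n k → Δ b n (+ k) ≡ + F n (λ d → 𝟙 (d ≡ᵇ k))
  Δ≡F n k = cong (+_) (countDegree≡F n k)

  -- The vertex 00 and the one ending in the largest letter have degree 1; the other `c` have degree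
  -- 2.
  F-two : ∀ h → F 2 h ≡ h 1 ℕ.+ (h 1 ℕ.+ c ℕ.* h 2)
  F-two h = trans (F-2+ 0 h) (cong (ℕ._+ W 0 h) (cong h (deg-zero {c} [])))

-- Integer form of the recurrence and initial values.

pos-linear : ∀ c x y → + (x ℕ.+ c ℕ.* y) ≡ + x + + c * + y
pos-linear c x y = trans (ℤ.pos-+ x (c ℕ.* y)) (cong (λ u → + x + u) (ℤ.pos-* c y))

Δ-recurrence : ∀ c n k → let b = suc c in
  Δ b (3 ℕ.+ n) (+ k) ≡
    Δ b (2 ℕ.+ n) (+ k - + 1)
    + Δ b (1 ℕ.+ n) (+ k - + 1)
    + (+ b - + 1) * Δ b (1 ℕ.+ n) (+ k - + 2)
    + Δ b n (+ k - + 1)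
    + (+ b - + 2) * Δ b n (+ k - + 2)
    - (+ b - + 1) * Δ b n (+ k - + 3)
-- The weight `h 0` picks out degree `k`; composing `h e` with `suc` gives `h (suc e)` by
-- computation.
Δ-recurrence c n k = isolate (F-recurrence c n (h 0))
    (Δ≡F c (3 ℕ.+ n) k) (Δ-shift c (2 ℕ.+ n) k 1)
    (Δ-shift c (1 ℕ.+ n) k 1) (Δ-shift c (1 ℕ.+ n) k 2)
    (Δ-shift c n k 1) (Δ-shift c n k 2) (Δ-shift c n k 3)
  where
  h : ℕ → ℕ → ℕ
  h e d = 𝟙 (e ℕ.+ d ≡ᵇ k)
  isolate : ∀ {f₃ f₂ u₁ u₂ v₁ v₂ v₃ a₃ a₂ x₁ x₂ y₁ y₂ y₃} →
    f₃ ℕ.+ (v₂ ℕ.+ c ℕ.* v₃) ≡ f₂ ℕ.+ (v₁ ℕ.+ c ℕ.* v₂) ℕ.+ (u₁ ℕ.+ c ℕ.* u₂) →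
    a₃ ≡ + f₃ → a₂ ≡ + f₂ → x₁ ≡ + u₁ → x₂ ≡ + u₂ →
    y₁ ≡ + v₁ → y₂ ≡ + v₂ → y₃ ≡ + v₃ →
    a₃ ≡ a₂ + x₁ + (+ suc c - + 1) * x₂ + y₁
           + (+ suc c - + 2) * y₂ - (+ suc c - + 1) * y₃
  isolate {f₃} {f₂} {u₁} {u₂} {v₁} {v₂} {v₃} eq refl refl refl refl refl refl refl = begin
    + f₃
      ≡⟨ cancel (+ f₃) (+ v₂ + + c * + v₃) ⟩
    (+ f₃ + (+ v₂ + + c * + v₃)) - (+ v₂ + + c * + v₃)
      ≡⟨ cong (_- (+ v₂ + + c * + v₃)) eqℤ ⟩
    (+ f₂ + (+ v₁ + + c * + v₂) + (+ u₁ + + c * + u₂)) - (+ v₂ + + c * + v₃)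
      ≡⟨ expand (+ c) (+ f₂) (+ u₁) (+ u₂) (+ v₁) (+ v₂) (+ v₃) ⟩
    _ ∎
    where
    cancel : ∀ x y → x ≡ (x + y) - y
    cancel = solve-∀
    eqℤ : + f₃ + (+ v₂ + + c * + v₃) ≡ + f₂ + (+ v₁ + + c * + v₂) + (+ u₁ + + c * + u₂)
    eqℤ = begin
      + f₃ + (+ v₂ + + c * + v₃)
        ≡⟨ cong (λ u → + f₃ + u) (pos-linear c v₂ v₃) ⟨
      + (f₃ ℕ.+ (v₂ ℕ.+ c ℕ.* v₃))
        ≡⟨ cong (+_) eq ⟩
      + f₂ + + (v₁ ℕ.+ c ℕ.* v₂) + + (u₁ ℕ.+ c ℕ.* u₂)
        ≡⟨ cong₂ (λ x y → + f₂ + x + y) (pos-linear c v₁ v₂) (pos-linear c u₁ u₂) ⟩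
      + f₂ + (+ v₁ + + c * + v₂) + (+ u₁ + + c * + u₂) ∎
    -- The coefficient b - 2 of `v₂` is `c` from `w F n` minus 1 from `t w F n`.
    expand : ∀ c f₂ u₁ u₂ v₁ v₂ v₃ →
      (f₂ + (v₁ + c * v₂) + (u₁ + c * u₂)) - (v₂ + c * v₃)
        ≡ f₂ + u₁ + ((+ 1 + c) - + 1) * u₂ + v₁
          + ((+ 1 + c) - + 2) * v₂ - ((+ 1 + c) - + 1) * v₃
    expand = solve-∀

theorem12 : ∀ (b : ℕ) → 1 ≤ℕ b →
    (∀ (n k : ℕ) → 3 ≤ℕ n →
    Δ b n (+ k) ≡
    Δ b (n ∸ 1) (+ k - + 1)
    + Δ b (n ∸ 2) (+ k - + 1)
    + (+ b - + 1) * Δ b (n ∸ 2) (+ k - + 2)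
    + Δ b (n ∸ 3) (+ k - + 1)
    + (+ b - + 2) * Δ b (n ∸ 3) (+ k - + 2)
    - (+ b - + 1) * Δ b (n ∸ 3) (+ k - + 3))
    × (Δ b 0 (+ 0) ≡ + 1)
    × (Δ b 1 (+ 0) ≡ + 1)
    × (Δ b 2 (+ 1) ≡ + 2)
    × (Δ b 2 (+ 2) ≡ + b - + 1)
    × (∀ (k : ℕ) → k ≢ 0 → Δ b 0 (+ k) ≡ + 0)
    × (∀ (k : ℕ) → k ≢ 0 → Δ b 1 (+ k) ≡ + 0)
    × (∀ (k : ℕ) → k ≢ 1 → k ≢ 2 → Δ b 2 (+ k) ≡ + 0)
theorem12 (suc c) (s≤s _) =
    (λ { (suc (suc (suc n))) k (s≤s (s≤s (s≤s _))) → Δ-recurrence c n k })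
  , Δ≡F c 0 0
  , Δ≡F c 1 0
  , trans (Δ₂ 1) (cong (λ u → + (2 ℕ.+ u)) (ℕ.*-zeroʳ c))
  , trans (Δ₂ 2) (cong (+_) (ℕ.*-identityʳ c))
  , (λ { zero 0≢0 → ⊥-elim (0≢0 refl) ; (suc k) _ → Δ≡F c 0 (suc k) })
  , (λ { zero 0≢0 → ⊥-elim (0≢0 refl) ; (suc k) _ → Δ≡F c 1 (suc k) })
  , λ { zero                _   _   → trans (Δ₂ 0) (cong (+_) (ℕ.*-zeroʳ c))
      ; (suc zero)          1≢1 _   → ⊥-elim (1≢1 refl)
      ; (suc (suc zero))    _   2≢2 → ⊥-elim (2≢2 refl)
      ; (suc (suc (suc k))) _   _   → trans (Δ₂ (3 ℕ.+ k)) (cong (+_) (ℕ.*-zeroʳ c)) }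
  where
  Δ₂ : ∀ k → Δ (suc c) 2 (+ k) ≡ + (𝟙 (1 ≡ᵇ k) ℕ.+ (𝟙 (1 ≡ᵇ k) ℕ.+ c ℕ.* 𝟙 (2 ≡ᵇ k)))
  Δ₂ k = trans (Δ≡F c 2 k) (cong (+_) (F-two c (λ d → 𝟙 (d ≡ᵇ k))))
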